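{- Let $m_1 \geq 3$ be an integer and let $m_2 \geq m_1(2m_1-1)$ be an integer. Then: (i) if $m_1+m_2 \equiv 0,3 \pmod 4$, there exists a graceful two nested cycles graph whose base cycle has length $m_2$ and whose chords form a cycle of length $m_1$, i.e. $\mathcal{N}_g(m_1,m_2)\neq\emptyset$; (ii) if $m_1+m_2 \equiv 1,2 \pmod 4$, there exists a near-graceful two nested cycles graph whose base cycle has length $m_2$ and whose chords form a cycle of length $m_1$, i.e. $\mathcal{N}_{n\text{ - }g}(m_1,m_2)\neq\emptyset$.
   Context: All graphs are finite and simple. A graph $G$ with $M$ edges is graceful if there is an injection $f:V(G)\to\{0,1,\ldots,M\}$ such that $\{|f(u)-f(v)| : uv\in E(G)\}=\{1,2,\ldots,M\}$. $G$ is near-graceful if it is not graceful and there is an injection $f:V(G)\to\{0,1,\ldots,M+1\}$ with $\{|f(u)-f(v)| : uv\in E(G)\}=\{1,2,\ldots,M-1\}\cup\{M+1\}$. A plane cycle with chords is a plane drawing of a Hamiltonian graph in which all vertices lie on the boundary cycle of the outer face (the base cycle), the remaining edges (chords) being drawn inside without crossings. A two nested cycles graph is a plane cycle with chords whose set of chords forms (induces) a cycle. $\mathcal{N}_g(m,n)$ (resp. $\mathcal{N}_{n\text{ - }g}(m,n)$) denotes the set of graceful (resp. near-graceful) two nested cycles graphs with base cycle of length $n$ and chord cycle of length $m$; such a graph has $m+n$ edges. -}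

module Defs where

open import Data.Nat using (ℕ; zero; suc; _+_; _*_; _∸_; _≤_; _<_; ∣_-_∣)
open import Data.Fin using (Fin; toℕ)
open import Data.Product using (Σ; _×_; ∃; ∃-syntax)
open import Data.Sum using (_⊎_)
open import Relation.Nullary using (¬_)
open import Relation.Binary.PropositionalEquality using (_≡_; _≢_)
open import Function.Definitions using (Injective)

BaseAdj : (n : ℕ) → Fin n → Fin n → Set
BaseAdj n u v = (toℕ v ≡ suc (toℕ u)) ⊎ (suc (toℕ u) ≡ n × toℕ v ≡ 0)

CycSucc : (m : ℕ) → Fin m → Fin m → Set
CycSucc m j k = (toℕ k ≡ suc (toℕ j)) ⊎ (suc (toℕ j) ≡ m × toℕ k ≡ 0)

Between : ℕ → ℕ → ℕ → Set
Between a b z = (a < z × z < b) ⊎ (b < z × z < a)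

-- Chords {a,b} and {c,d} (vertices in convex position, in order 0..n-1)
-- cross iff the four endpoints are distinct and exactly one of c,d lies
-- strictly between a and b (i.e. they interleave in the cyclic order).
Cross : ℕ → ℕ → ℕ → ℕ → Set
Cross a b c d =
  (a ≢ c × a ≢ d × b ≢ c × b ≢ d) ×
  ((Between a b c × ¬ Between a b d) ⊎ (Between a b d × ¬ Between a b c))

-- A two nested cycles graph with chord cycle of length m and base cycle of
-- length n: the base cycle is 0,1,…,n-1 (Hamiltonian, on the outer face), and
-- the chords are the edges {c j, c (j+1 mod m)} of a cycle of length m on
-- distinct vertices c 0, …, c (m-1); chords are not base edges and no two
-- chords cross (so they can be drawn inside without crossings).
record TwoNestedCycles (m n : ℕ) : Set where
  field
    m≥3   : 3 ≤ m
    n≥3   : 3 ≤ n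
    c     : Fin m → Fin n
    c-inj : Injective _≡_ _≡_ c
    chord-not-base : ∀ j k → CycSucc m j k →
      ¬ BaseAdj n (c j) (c k) × ¬ BaseAdj n (c k) (c j)
    non-crossing : ∀ j k j′ k′ → CycSucc m j k → CycSucc m j′ k′ →
      ¬ Cross (toℕ (c j)) (toℕ (c k)) (toℕ (c j′)) (toℕ (c k′))

module _ {m n : ℕ} (G : TwoNestedCycles m n) where
  open TwoNestedCycles G

  Adj : Fin n → Fin n → Set
  Adj u v = BaseAdj n u v ⊎ BaseAdj n v u ⊎
    (∃[ j ] ∃[ k ] (CycSucc m j k × ((u ≡ c j × v ≡ c k) ⊎ (u ≡ c k × v ≡ c j))))

  -- number of edges
  M : ℕ
  M = m + n

  Graceful : Set
  Graceful = Σ (Fin n → ℕ) λ f →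
    Injective _≡_ _≡_ f ×
    (∀ v → f v ≤ M) ×
    (∀ u v → Adj u v → 1 ≤ ∣ f u - f v ∣ × ∣ f u - f v ∣ ≤ M) ×
    (∀ k → 1 ≤ k → k ≤ M → ∃[ u ] ∃[ v ] (Adj u v × ∣ f u - f v ∣ ≡ k))

  NGRange : ℕ → Set
  NGRange k = (1 ≤ k × k ≤ M ∸ 1) ⊎ (k ≡ suc M)

  NearGraceful : Set
  NearGraceful = ¬ Graceful × Σ (Fin n → ℕ) λ f →
    Injective _≡_ _≡_ f ×
    (∀ v → f v ≤ suc M) ×
    (∀ u v → Adj u v → NGRange ∣ f u - f v ∣) ×
    (∀ k → NGRange k → ∃[ u ] ∃[ v ] (Adj u v × ∣ f u - f v ∣ ≡ k))

{-# OPTIONS --safe #-}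
module Submission where

-- Let M = m + n, and let δ = 0 or 1 be the parity of 1 + 2 + … + M, so that δ = 1 is the
-- near-graceful case. Both kinds of edges form cycles, so the sum of the edge differences is even:
-- this excludes gracefulness when δ = 1.
--
-- For the construction, the base cycle is a zigzag: the labels at even positions increase from 0,
-- those at odd positions decrease from M + δ, and the differences along the path decrease. Such a
-- path realises any prescribed set of n − 1 differences, and we let it skip 1, …, m − 1,
-- T = 1 + … + (m − 1), and e (besides M when δ = 1). The chords join even positions, near the start,
-- with labels T − (1 + … + j) for 0 ≤ j < m; they realise 1, …, m − 1 and T. The edge closing the
-- zigzag has to realise e. Its difference is an alternating sum which does not depend on e as long
-- as e is skipped between a decreasing and an increasing step, that is when M − e is even; parity of
-- the total sum shows that this value has the right parity to be taken as e.

open import Defs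
open import Data.Fin as F using (Fin; toℕ; inject₁; fromℕ; fromℕ<)
open import Data.Fin.Properties
  using (toℕ-injective; toℕ-inject₁; toℕ-fromℕ; toℕ-fromℕ<; toℕ<n)
open import Data.List using (List; []; _∷_; _++_; length; tabulate)
open import Data.List.Membership.Propositional using (_∈_)
open import Data.List.Membership.Propositional.Properties
  using (∈-∃++; ∈-++⁺ˡ; ∈-++⁺ʳ; ∈-++⁻; ∈-tabulate⁺)
open import Data.List.Properties using (length-++; length-tabulate)
open import Data.List.Relation.Unary.Any using (here; there)
open import Data.Nat
open import Data.Nat.DivMod using (m≡m%n+[m/n]*n)
open import Data.Nat.ListAction using (sum)
open import Data.Nat.ListAction.Properties using (sum-++)
open import Data.Nat.Properties
open import Data.Nat.Tactic.RingSolver using (solve-∀; solve)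
open import Data.Parity using (0ℙ; 1ℙ; _⁻¹) renaming (_+_ to _⊕_)
import Data.Parity.Properties as ℙ
open import Data.Product using (Σ; _×_; _,_; ∃-syntax; ∃₂)
open import Data.Sum using (_⊎_; inj₁; inj₂; [_,_]′)
open import Function using (_∘_)
open import Function.Definitions using (Injective)
open import Relation.Binary.Definitions using (tri<; tri≈; tri>)
open import Relation.Binary.PropositionalEquality
open import Relation.Nullary using (¬_; yes; no; contradiction)

-- Parity of the sum of the differences

tri : ℕ → ℕ
tri zero    = 0
tri (suc j) = suc j + tri j

tri-+ : ∀ x y → tri (x + y) ≡ tri x + tri y + x * y
tri-+ zero    y = sym (+-identityʳ (tri y))
tri-+ (suc x) y = trans (cong (suc (x + y) +_) (tri-+ x y)) (lemma x y (tri x) (tri y))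
  where
  lemma : ∀ x y a b → suc (x + y) + (a + b + x * y) ≡ suc x + a + b + (y + x * y)
  lemma = solve-∀

2*tri : ∀ x → 2 * tri x ≡ x * suc x
2*tri zero    = refl
2*tri (suc x) = trans (*-distribˡ-+ 2 (suc x) (tri x))
  (trans (cong (2 * suc x +_) (2*tri x)) (lemma x))
  where
  lemma : ∀ x → 2 * suc x + x * suc x ≡ suc x * suc (suc x)
  lemma = solve-∀

parity-2* : ∀ x → parity (2 * x) ≡ 0ℙ
parity-2* = ℙ.*-homo-* 2

-- Four consecutive integers `x + 1`, ..., `x + 4` add up to the even number `2 * (5 + 2 * x)`.
parity-tri-+4* : ∀ a b → parity (tri (a + b * 4)) ≡ parity (tri a)
parity-tri-+4* a zero    = cong (parity ∘ tri) (+-identityʳ a)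
parity-tri-+4* a (suc b) = begin
  parity (tri (a + (4 + b * 4)))                ≡⟨ cong (parity ∘ tri) (lemma₁ a (b * 4)) ⟩
  parity (tri (4 + (a + b * 4)))                ≡⟨ cong parity (lemma₂ (a + b * 4) (tri (a + b * 4))) ⟩
  parity (tri x + 2 * (5 + 2 * x))              ≡⟨ ℙ.+-homo-+ (tri x) (2 * (5 + 2 * x)) ⟩
  parity (tri x) ⊕ parity (2 * (5 + 2 * x))     ≡⟨ cong (parity (tri x) ⊕_) (parity-2* (5 + 2 * x)) ⟩
  parity (tri x) ⊕ 0ℙ                           ≡⟨ ℙ.+-identityʳ (parity (tri x)) ⟩
  parity (tri x)                                ≡⟨ parity-tri-+4* a b ⟩
  parity (tri a)                                ∎
  where
  open ≡-Reasoning
  x = a + b * 4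
  lemma₁ : ∀ a y → a + (4 + y) ≡ 4 + (a + y)
  lemma₁ = solve-∀
  lemma₂ : ∀ x s → 4 + x + (3 + x + (2 + x + (1 + x + s))) ≡ s + 2 * (5 + 2 * x)
  lemma₂ = solve-∀

parity-tri-%4 : ∀ x → parity (tri x) ≡ parity (tri (x % 4))
parity-tri-%4 x = trans (cong (parity ∘ tri) (m≡m%n+[m/n]*n x 4)) (parity-tri-+4* (x % 4) (x / 4))

parity-∣-∣ : ∀ a b → parity ∣ a - b ∣ ≡ parity a ⊕ parity b
parity-∣-∣ zero    b       = refl
parity-∣-∣ (suc a) zero    = sym (ℙ.+-identityʳ (parity (suc a)))
parity-∣-∣ (suc a) (suc b) = trans (parity-∣-∣ a b) (lemma _ _ _ _ (ℙ.suc-homo-⁻¹ a) (ℙ.suc-homo-⁻¹ b))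
  where
  lemma : ∀ p p′ q q′ → p′ ⁻¹ ≡ p → q′ ⁻¹ ≡ q → p ⊕ q ≡ p′ ⊕ q′
  lemma _ 0ℙ _ 0ℙ refl refl = refl
  lemma _ 0ℙ _ 1ℙ refl refl = refl
  lemma _ 1ℙ _ 0ℙ refl refl = refl
  lemma _ 1ℙ _ 1ℙ refl refl = refl

walk : ∀ n → (Fin (suc n) → ℕ) → List ℕ
walk n g = tabulate {n = n} λ i → ∣ g (inject₁ i) - g (F.suc i) ∣

-- Modulo 2 each `∣ a - b ∣` is `a + b`, so every interior vertex is counted twice and only the two
-- ends remain.
parity-walk : ∀ n g → parity (sum (walk n g)) ≡ parity (g F.zero) ⊕ parity (g (fromℕ n))
parity-walk zero    g = sym (ℙ.p+p≡0ℙ (parity (g F.zero)))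
parity-walk (suc n) g = begin
  parity (d + sum w)                                                    ≡⟨ ℙ.+-homo-+ d (sum w) ⟩
  parity d ⊕ parity (sum w)                                             ≡⟨ cong₂ _⊕_ (parity-∣-∣ (g F.zero) (g (F.suc F.zero))) (parity-walk n (g ∘ F.suc)) ⟩
  (parity (g F.zero) ⊕ q) ⊕ (q ⊕ parity (g (fromℕ (suc n))))            ≡⟨ lemma (parity (g F.zero)) q (parity (g (fromℕ (suc n)))) ⟩
  parity (g F.zero) ⊕ parity (g (fromℕ (suc n)))                        ∎
  where
  open ≡-Reasoning
  d = ∣ g F.zero - g (F.suc F.zero) ∣
  w = walk n (g ∘ F.suc)
  q = parity (g (F.suc F.zero))
  lemma : ∀ p q r → (p ⊕ q) ⊕ (q ⊕ r) ≡ p ⊕ r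
  lemma p 0ℙ r = cong (_⊕ r) (ℙ.+-identityʳ p)
  lemma 0ℙ 1ℙ 0ℙ = refl
  lemma 0ℙ 1ℙ 1ℙ = refl
  lemma 1ℙ 1ℙ 0ℙ = refl
  lemma 1ℙ 1ℙ 1ℙ = refl

cycleDiffs : ∀ {n} → (Fin n → ℕ) → List ℕ
cycleDiffs {zero}  g = []
cycleDiffs {suc n} g = ∣ g (fromℕ n) - g F.zero ∣ ∷ walk n g

length-cycleDiffs : ∀ {n} (g : Fin n → ℕ) → length (cycleDiffs g) ≡ n
length-cycleDiffs {zero}  g = refl
length-cycleDiffs {suc n} g = cong suc (length-tabulate {n = n} _)

parity-cycleDiffs : ∀ {n} (g : Fin n → ℕ) → parity (sum (cycleDiffs g)) ≡ 0ℙ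
parity-cycleDiffs {zero}  g = refl
parity-cycleDiffs {suc n} g = begin
  parity (d + sum (walk n g))        ≡⟨ ℙ.+-homo-+ d _ ⟩
  parity d ⊕ parity (sum (walk n g)) ≡⟨ cong₂ _⊕_ (parity-∣-∣ (g (fromℕ n)) (g F.zero)) (parity-walk n g) ⟩
  (p ⊕ q) ⊕ (q ⊕ p)                  ≡⟨ cong ((p ⊕ q) ⊕_) (ℙ.+-comm q p) ⟩
  (p ⊕ q) ⊕ (p ⊕ q)                  ≡⟨ ℙ.p+p≡0ℙ (p ⊕ q) ⟩
  0ℙ                                 ∎
  where
  open ≡-Reasoning
  d = ∣ g (fromℕ n) - g F.zero ∣
  p = parity (g (fromℕ n))
  q = parity (g F.zero)

∈-cycleDiffs : ∀ {n} (g : Fin n → ℕ) {u v} → CycSucc n u v → ∣ g u - g v ∣ ∈ cycleDiffs g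
∈-cycleDiffs {suc n} g {u} {F.zero}  (inj₂ (u-last , _)) =
  subst (λ w → ∣ g w - g F.zero ∣ ∈ cycleDiffs g)
    (toℕ-injective (trans (toℕ-fromℕ n) (sym (suc-injective u-last)))) (here refl)
∈-cycleDiffs {suc n} g {u} {F.suc v} (inj₁ eq) =
  subst (λ w → ∣ g w - g (F.suc v) ∣ ∈ cycleDiffs g)
    (toℕ-injective (trans (toℕ-inject₁ v) (suc-injective eq))) (there (∈-tabulate⁺ v))

-- `M` entries that hit all of 1, ..., `M` hit each exactly once. The induction deletes one
-- occurrence of the largest value; the smaller values survive the deletion.
sum-of-cover : ∀ M (ds : List ℕ) → length ds ≡ M → (∀ k → 1 ≤ k → k ≤ M → k ∈ ds) → sum ds ≡ tri M
sum-of-cover zero    []  len cover = refl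
sum-of-cover (suc M) ds len cover with ∈-∃++ (cover (suc M) (s≤s z≤n) ≤-refl)
... | as , bs , refl = begin
  sum (as ++ suc M ∷ bs)        ≡⟨ sum-++ as _ ⟩
  sum as + (suc M + sum bs)     ≡⟨ lemma (sum as) (suc M) (sum bs) ⟩
  suc M + (sum as + sum bs)     ≡⟨ cong (suc M +_) (sum-++ as bs) ⟨
  suc M + sum (as ++ bs)        ≡⟨ cong (suc M +_) (sum-of-cover M (as ++ bs) len′ cover′) ⟩
  suc M + tri M                 ∎
  where
  open ≡-Reasoning
  lemma : ∀ a b c → a + (b + c) ≡ b + (a + c)
  lemma = solve-∀
  len′ : length (as ++ bs) ≡ M
  len′ = suc-injective (trans (cong suc (length-++ as)) (trans (sym (+-suc _ _)) (trans (sym (length-++ as)) len)))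
  cover′ : ∀ k → 1 ≤ k → k ≤ M → k ∈ as ++ bs
  cover′ k 1≤k k≤M with ∈-++⁻ as (cover k 1≤k (m≤n⇒m≤1+n k≤M))
  ... | inj₁ k∈as         = ∈-++⁺ˡ k∈as
  ... | inj₂ (here refl)  = contradiction k≤M 1+n≰n
  ... | inj₂ (there k∈bs) = ∈-++⁺ʳ as k∈bs

graceful⇒even : ∀ {m n} (G : TwoNestedCycles m n) → Graceful G → parity (tri (m + n)) ≡ 0ℙ
graceful⇒even {m} {n} G (f , _ , _ , _ , onto) = begin
  parity (tri (m + n))                        ≡⟨ cong parity (sum-of-cover (m + n) diffs len cover) ⟨
  parity (sum diffs)                          ≡⟨ cong parity (sum-++ (cycleDiffs (f ∘ c)) _) ⟩
  parity (sum (cycleDiffs (f ∘ c)) + sum (cycleDiffs f))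
    ≡⟨ ℙ.+-homo-+ (sum (cycleDiffs (f ∘ c))) _ ⟩
  parity (sum (cycleDiffs (f ∘ c))) ⊕ parity (sum (cycleDiffs f))
    ≡⟨ cong₂ _⊕_ (parity-cycleDiffs (f ∘ c)) (parity-cycleDiffs f) ⟩
  0ℙ                                          ∎
  where
  open ≡-Reasoning
  open TwoNestedCycles G
  diffs : List ℕ
  diffs = cycleDiffs (f ∘ c) ++ cycleDiffs f
  len : length diffs ≡ m + n
  len = trans (length-++ (cycleDiffs (f ∘ c))) (cong₂ _+_ (length-cycleDiffs (f ∘ c)) (length-cycleDiffs f))
  edge∈ : ∀ u v → Adj G u v → ∣ f u - f v ∣ ∈ diffs
  -- `BaseAdj n` and `CycSucc n` unfold to the same type, so one membership lemma serves both
  -- cycles: the base cycle under `f`, the chord cycle under `f ∘ c`.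
  edge∈ u v (inj₁ b)        = ∈-++⁺ʳ (cycleDiffs (f ∘ c)) (∈-cycleDiffs f b)
  edge∈ u v (inj₂ (inj₁ b)) = subst (_∈ diffs) (∣-∣-comm (f v) (f u))
                                (∈-++⁺ʳ (cycleDiffs (f ∘ c)) (∈-cycleDiffs f b))
  edge∈ _ _ (inj₂ (inj₂ (j , k , s , inj₁ (refl , refl)))) = ∈-++⁺ˡ (∈-cycleDiffs (f ∘ c) s)
  edge∈ _ _ (inj₂ (inj₂ (j , k , s , inj₂ (refl , refl)))) =
    subst (_∈ diffs) (∣-∣-comm (f (c j)) (f (c k))) (∈-++⁺ˡ (∈-cycleDiffs (f ∘ c) s))
  cover : ∀ k → 1 ≤ k → k ≤ m + n → k ∈ diffs
  cover k 1≤k k≤M with onto k 1≤k k≤M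
  ... | u , v , adj , refl = edge∈ u v adj

-- Zigzag labellings

-- Linear inequalities are proved by adding hypotheses up to A ≤ B; the rest is a semiring identity
-- in which s is the slack.
≤-cert : ∀ {A B X Y} s → A ≤ B → X + B + s ≡ Y + A → X ≤ Y
≤-cert {A} {B} {X} {Y} s A≤B eq = +-cancelʳ-≤ A X Y (begin
  X + A      ≤⟨ +-monoʳ-≤ X A≤B ⟩
  X + B      ≤⟨ m≤m+n (X + B) s ⟩
  X + B + s  ≡⟨ eq ⟩
  Y + A      ∎)
  where open ≤-Reasoning

-- The version with rounding: the certificate yields only `2 * X ≤ 1 + 2 * Y`, and integrality does
-- the rest.
≤-cert₂ : ∀ {A B X Y} s → A ≤ B → 2 * X + B + s ≡ 1 + 2 * Y + A → X ≤ Y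
≤-cert₂ {X = X} {Y} s A≤B eq with X ≤? Y
... | yes X≤Y = X≤Y
... | no  X≰Y = contradiction (≤-cert s A≤B eq) (<⇒≱ (begin-strict
  1 + 2 * Y      <⟨ n<1+n _ ⟩
  2 + 2 * Y      ≡⟨ *-suc 2 Y ⟨
  2 * suc Y      ≤⟨ *-monoʳ-≤ 2 (≰⇒> X≰Y) ⟩
  2 * X          ∎))
  where open ≤-Reasoning

-- Threshold indicators and alternating sequences

χ : ℕ → ℕ → ℕ
χ zero    k       = 1
χ (suc a) zero    = 0
χ (suc a) (suc k) = χ a k

χ≤1 : ∀ a k → χ a k ≤ 1
χ≤1 zero    k       = ≤-refl
χ≤1 (suc a) zero    = z≤n
χ≤1 (suc a) (suc k) = χ≤1 a k

χ-mono : ∀ a {j k} → j ≤ k → χ a j ≤ χ a k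
χ-mono zero    j≤k       = ≤-refl
χ-mono (suc a) z≤n       = z≤n
χ-mono (suc a) (s≤s j≤k) = χ-mono a j≤k

χ-≤ : ∀ {a k} → a ≤ k → χ a k ≡ 1
χ-≤ z≤n       = refl
χ-≤ (s≤s a≤k) = χ-≤ a≤k

χ-> : ∀ {a k} → k < a → χ a k ≡ 0
χ-> {suc a} {zero}  _         = refl
χ-> {suc a} {suc k} (s≤s k<a) = χ-> k<a

χ-even : ∀ a i → χ (2 * a) (2 * i) ≡ χ a i
χ-even zero    i       = refl
χ-even (suc a) zero    = refl
χ-even (suc a) (suc i) = trans (cong₂ χ (*-suc 2 a) (*-suc 2 i)) (χ-even a i)

χ-odd : ∀ a i → χ (2 * a) (suc (2 * i)) ≡ χ a i
χ-odd zero    i       = refl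
χ-odd (suc a) zero    = cong (λ b → χ b 1) (*-suc 2 a)
χ-odd (suc a) (suc i) = trans (cong₂ (λ b k → χ b (suc k)) (*-suc 2 a) (*-suc 2 i)) (χ-odd a i)

χ-even′ : ∀ a i → χ (suc (2 * a)) (2 * i) ≡ χ (suc a) i
χ-even′ a zero    = refl
χ-even′ a (suc i) = trans (cong (χ (suc (2 * a))) (*-suc 2 i)) (χ-odd a i)

-- `t` is the parity of the threshold and `u` its complement, selecting one summand. At the even
-- step `2 * i` an odd threshold `2 * a + 1` is reached one index later than `2 * a`; at the odd
-- step `2 * i + 1` both are reached as soon as `a ≤ i`.
χ-even-+ : ∀ a {t u} i → t + u ≡ 1 → χ (2 * a + t) (2 * i) ≡ u * χ a i + t * χ (suc a) i
χ-even-+ a {zero} i refl rewrite +-identityʳ (2 * a) =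
  trans (χ-even a i) (sym (trans (+-identityʳ _) (*-identityˡ _)))
χ-even-+ a {suc zero} i refl rewrite +-comm (2 * a) 1 = trans (χ-even′ a i) (sym (*-identityˡ _))

χ-odd-+ : ∀ a {t u} i → t + u ≡ 1 → χ (2 * a + t) (suc (2 * i)) ≡ χ a i
χ-odd-+ a {zero}     i refl rewrite +-identityʳ (2 * a) = χ-odd a i
χ-odd-+ a {suc zero} i refl rewrite +-comm (2 * a) 1    = χ-even a i

data Half : ℕ → Set where
  even : ∀ i → Half (2 * i)
  odd  : ∀ i → Half (suc (2 * i))

half : ∀ k → Half k
half zero    = even 0
half (suc k) with half k
... | even i = odd i
... | odd i  = subst Half (*-suc 2 i) (even (suc i))

zigzag : (ℕ → ℕ) → (ℕ → ℕ) → ℕ → ℕ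
zigzag L H zero          = L 0
zigzag L H (suc zero)    = H 0
zigzag L H (suc (suc k)) = zigzag (L ∘ suc) (H ∘ suc) k

zigzag-even : ∀ L H i → zigzag L H (2 * i) ≡ L i
zigzag-even L H zero    = refl
zigzag-even L H (suc i) = trans (cong (zigzag L H) (*-suc 2 i)) (zigzag-even (L ∘ suc) (H ∘ suc) i)

zigzag-odd : ∀ L H i → zigzag L H (suc (2 * i)) ≡ H i
zigzag-odd L H zero    = refl
zigzag-odd L H (suc i) = trans (cong (zigzag L H ∘ suc) (*-suc 2 i)) (zigzag-odd (L ∘ suc) (H ∘ suc) i)

mono⇒injective : ∀ (g : ℕ → ℕ) → (∀ {i j} → i < j → g i < g j) → ∀ {i j} → g i ≡ g j → i ≡ j
mono⇒injective g mono {i} {j} eq with <-cmp i j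
... | tri< i<j _ _ = contradiction eq (<⇒≢ (mono i<j))
... | tri≈ _ i≡j _ = i≡j
... | tri> _ _ j<i = contradiction (sym eq) (<⇒≢ (mono j<i))

*-≤1 : ∀ {a b} → b ≤ 1 → a * b ≤ a
*-≤1 {a} b≤1 = ≤-trans (*-monoʳ-≤ a b≤1) (≤-reflexive (*-identityʳ a))

-- The values required of a graceful (δ = 0) or near-graceful (δ = 1) labelling with M edges.
InRange : ℕ → ℕ → ℕ → Set
InRange M δ v = (1 ≤ v × v + δ ≤ M) ⊎ v ≡ M + δ

-- The last position is `2 * q + ε`, a low vertex if `ε = 0` and a high one if `ε = 1`; `e` is its
-- label. Without skipping, step `k` would have difference `M − k`, so `e` is met at step `2 * p`.
-- With `e` already skipped, `T` is met at step `M − T − 1 = 2 * r + t`.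
module Labelling
  (m n M q ε δ t u r p T e : ℕ)
  (n≡ : n ≡ suc (2 * q + ε)) (M≡ : M ≡ m + n) (e≡ : e ≡ q + δ + t + ε * m)
  (e+2p≡M : e + 2 * p ≡ M) (2r+t≡ : 2 * r + t + T + 1 ≡ M) (t+u≡1 : t + u ≡ 1)
  (ε≤1 : ε ≤ 1) (δ≤1 : δ ≤ 1) (3≤m : 3 ≤ m) (m≤T : m ≤ T) (4T+m≤n : 4 * T + m ≤ n)
  where

  _⊞_ : ∀ {a b c d} → a ≤ b → c ≤ d → a + c ≤ b + d
  _⊞_ = +-mono-≤
  infixl 6 _⊞_

  t≤1 : t ≤ 1
  t≤1 = ≤-trans (m≤m+n t u) (≤-reflexive t+u≡1)

  2T<q : 2 * T + 1 ≤ q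
  2T<q = ≤-cert₂ 0 (4T+m≤n ⊞ ≤-reflexive n≡ ⊞ ε≤1 ⊞ 3≤m)
    (solve (T ∷ m ∷ n ∷ q ∷ ε ∷ []))

  T≤r : T ≤ r
  T≤r = ≤-cert₂ (T + m + 2) (4T+m≤n ⊞ ≤-reflexive (sym M≡) ⊞ ≤-reflexive (sym 2r+t≡) ⊞ t≤1 ⊞ 3≤m)
    (solve (T ∷ m ∷ n ∷ M ∷ r ∷ t ∷ []))

  1≤T : 1 ≤ T
  1≤T = ≤-trans (s≤s z≤n) (≤-trans 3≤m m≤T)

  q≤e : q ≤ e
  q≤e = ≤-cert (δ + t + ε * m) (≤-reflexive (sym e≡)) (solve (q ∷ δ ∷ t ∷ ε ∷ m ∷ e ∷ []))

  T<e : suc T ≤ e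
  T<e = ≤-cert T (2T<q ⊞ q≤e) (solve (T ∷ q ∷ e ∷ []))

  ε*m≤m : ε * m ≤ m
  ε*m≤m = ≤-trans (*-monoˡ-≤ m ε≤1) (≤-reflexive (*-identityˡ m))

  -- Keeps the first edge out of reach of the skips, so that it can take `M + δ`.
  1≤p : 1 ≤ p
  1≤p = ≤-cert₂ (T + ε)
    (2T<q ⊞ 1≤T ⊞ ≤-reflexive e≡ ⊞ ≤-reflexive (sym n≡) ⊞ ≤-reflexive (sym M≡) ⊞ ≤-reflexive (sym e+2p≡M) ⊞ δ≤1 ⊞ t≤1 ⊞ ε*m≤m)
    (solve (T ∷ q ∷ e ∷ n ∷ M ∷ p ∷ δ ∷ t ∷ ε ∷ m ∷ []))

  -- The differences decrease along the path and `T < e`, so `e` is skipped first.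
  2p≤2r+t : 2 * p ≤ 2 * r + t
  2p≤2r+t = ≤-cert 0 (T<e ⊞ ≤-reflexive e+2p≡M ⊞ ≤-reflexive (sym 2r+t≡))
    (solve (T ∷ e ∷ p ∷ M ∷ r ∷ t ∷ []))

  -- The two sides differ by `T − m`. If `T = m`, the threshold is the last position, already past
  -- the last step, and `T` is left out because the path stops above it.
  2r+t≤2q+ε : 2 * r + t ≤ 2 * q + ε
  2r+t≤2q+ε = ≤-cert 0 (m≤T ⊞ ≤-reflexive n≡ ⊞ ≤-reflexive M≡ ⊞ ≤-reflexive 2r+t≡)
    (solve (T ∷ m ∷ n ∷ M ∷ r ∷ t ∷ q ∷ ε ∷ []))

  -- The path difference at step k is M − k − χ (2p) k − χ (2r + t) k for k ≥ 1: the two indicators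
  -- account for skipping e and T. Skipping e always falls between steps 2p − 1 and 2p, which lowers
  -- the high labels; skipping T lowers the high labels if t = 0 and raises the low ones if t = 1.
  X L H lab : ℕ → ℕ
  X i = i + χ p i + u * χ r i
  L i = i + δ * χ 1 i + t * χ (suc r) i
  H i = M + δ ∸ X i
  lab = zigzag L H

  low≤q : ∀ {i} → 2 * i < n → i ≤ q
  low≤q {i} 2i<n = ≤-cert₂ 0 (2i<n ⊞ ≤-reflexive n≡ ⊞ ε≤1)
    (solve (i ∷ n ∷ q ∷ ε ∷ []))

  high<q+ε : ∀ {i} → suc (2 * i) < n → suc i ≤ q + ε
  high<q+ε {i} 2i+1<n = ≤-cert₂ ε (2i+1<n ⊞ ≤-reflexive n≡)
    (solve (i ∷ n ∷ q ∷ ε ∷ []))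

  L≤ : ∀ {i} → 2 * i < n → L i ≤ q + δ + t
  L≤ {i} 2i<n = low≤q 2i<n ⊞ *-≤1 (χ≤1 1 i) ⊞ *-≤1 (χ≤1 (suc r) i)

  X≤ : ∀ {i} → suc (2 * i) < n → X i ≤ q + ε + u
  X≤ {i} 2i+1<n = ≤-trans (≤-reflexive (+-comm i (χ p i)) ⊞ ≤-refl)
    (≤-trans (χ≤1 p i ⊞ ≤-refl ⊞ *-≤1 (χ≤1 r i)) (high<q+ε 2i+1<n ⊞ ≤-refl))

  -- The upper bounds for `X` and `L` leave exactly `m` out of `M + δ`: this is the guaranteed gap
  -- between low and high labels. For odd `n − 1` it also evaluates the closing edge.
  gap-identity : q + ε + u + (m + (q + δ + t)) ≡ M + δ
  gap-identity = trans (lemma q ε u m δ t) (trans (cong (λ x → m + (2 * q + ε + x) + δ) t+u≡1)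
    (cong (_+ δ) (trans (cong (m +_) (trans (+-comm _ 1) (sym n≡))) (sym M≡))))
    where
    lemma : ∀ q ε u m δ t → q + ε + u + (m + (q + δ + t)) ≡ m + (2 * q + ε + (t + u)) + δ
    lemma = solve-∀

  H+X : ∀ {i} → suc (2 * i) < n → H i + X i ≡ M + δ
  H+X {i} 2i+1<n = m∸n+n≡m (≤-trans (X≤ {i} 2i+1<n) (≤-trans (m≤m+n _ _) (≤-reflexive gap-identity)))

  m+L≤H : ∀ {i j} → 2 * i < n → suc (2 * j) < n → m + L i ≤ H j
  m+L≤H {i} {j} 2i<n 2j+1<n = +-cancelˡ-≤ (X j) _ _ (begin
    X j + (m + L i)                      ≤⟨ X≤ {j} 2j+1<n ⊞ (≤-refl {m} ⊞ L≤ {i} 2i<n) ⟩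
    q + ε + u + (m + (q + δ + t))        ≡⟨ gap-identity ⟩
    M + δ                                ≡⟨ H+X {j} 2j+1<n ⟨
    H j + X j                            ≡⟨ +-comm (H j) (X j) ⟩
    X j + H j                            ∎)
    where open ≤-Reasoning

  L<H : ∀ {i j} → 2 * i < n → suc (2 * j) < n → L i < H j
  L<H {i} {j} 2i<n 2j+1<n = ≤-trans (+-monoˡ-≤ (L i) (≤-trans (s≤s z≤n) 3≤m)) (m+L≤H {i} {j} 2i<n 2j+1<n)

  L-mono : ∀ {i j} → i < j → L i < L j
  L-mono i<j = +-mono-<-≤ (+-mono-<-≤ i<j (*-monoʳ-≤ δ (χ-mono 1 (<⇒≤ i<j))))
    (*-monoʳ-≤ t (χ-mono (suc r) (<⇒≤ i<j)))

  X-mono : ∀ {i j} → i < j → X i < X j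
  X-mono i<j = +-mono-<-≤ (+-mono-<-≤ i<j (χ-mono p (<⇒≤ i<j))) (*-monoʳ-≤ u (χ-mono r (<⇒≤ i<j)))

  lab-injective : ∀ {j k} → j < n → k < n → lab j ≡ lab k → j ≡ k
  lab-injective {j} {k} j<n k<n eq with half j | half k
  ... | even a | even b = cong (2 *_) (mono⇒injective L L-mono
    (trans (sym (zigzag-even L H a)) (trans eq (zigzag-even L H b))))
  ... | even a | odd b  = contradiction (trans (sym (zigzag-even L H a)) (trans eq (zigzag-odd L H b)))
    (<⇒≢ (L<H {a} {b} j<n k<n))
  ... | odd a  | even b = contradiction (trans (sym (zigzag-even L H b)) (trans (sym eq) (zigzag-odd L H a)))
    (<⇒≢ (L<H {b} {a} k<n j<n))
  ... | odd a  | odd b  = cong (suc ∘ (2 *_)) (mono⇒injective X X-mono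
    (+-cancelˡ-≡ (H a) (X a) (X b) (trans (H+X {a} j<n)
      (sym (trans (cong (_+ X b) (trans (sym (zigzag-odd L H a)) (trans eq (zigzag-odd L H b)))) (H+X {b} k<n))))))

  lab≤ : ∀ {k} → k < n → lab k ≤ M + δ
  lab≤ {k} k<n with half k
  ... | even i = begin
    lab (2 * i)                   ≡⟨ zigzag-even L H i ⟩
    L i                           ≤⟨ L≤ {i} k<n ⟩
    q + δ + t                     ≤⟨ m≤n+m _ m ⟩
    m + (q + δ + t)               ≤⟨ m≤n+m _ (q + ε + u) ⟩
    q + ε + u + (m + (q + δ + t)) ≡⟨ gap-identity ⟩
    M + δ                         ∎
    where open ≤-Reasoning
  ... | odd i  = ≤-trans (≤-reflexive (zigzag-odd L H i)) (m∸n≤m (M + δ) (X i))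

  edge-even : ∀ i → suc (2 * i) < n →
    ∣ lab (2 * i) - lab (suc (2 * i)) ∣ + (2 * i + χ (2 * p) (2 * i) + χ (2 * r + t) (2 * i) + δ * χ 1 (2 * i)) ≡ M + δ
  edge-even i 2i+1<n = begin
    ∣ lab (2 * i) - lab (suc (2 * i)) ∣ + (2 * i + χ (2 * p) (2 * i) + χ (2 * r + t) (2 * i) + δ * χ 1 (2 * i))
      ≡⟨ cong₂ _+_ (trans (cong₂ ∣_-_∣ (zigzag-even L H i) (zigzag-odd L H i)) (m≤n⇒∣m-n∣≡n∸m (<⇒≤ L<)))
           (cong₂ _+_ (cong₂ _+_ (cong (2 * i +_) (χ-even p i)) (χ-even-+ r i t+u≡1)) (cong (δ *_) (χ1-2* i))) ⟩
    (H i ∸ L i) + (2 * i + χ p i + (u * χ r i + t * χ (suc r) i) + δ * χ 1 i)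
      -- The skip of `T` splits into the share `u * χ r i` contained in `X i` and the share
      -- `t * χ (suc r) i` contained in `L i`.
      ≡⟨ lemma (H i ∸ L i) i (χ p i) (u * χ r i) (t * χ (suc r) i) (δ * χ 1 i) ⟩
    (H i ∸ L i) + L i + X i   ≡⟨ cong (_+ X i) (m∸n+n≡m (<⇒≤ L<)) ⟩
    H i + X i                 ≡⟨ H+X {i} 2i+1<n ⟩
    M + δ                     ∎
    where
    open ≡-Reasoning
    L< : L i < H i
    L< = L<H {i} {i} (<-trans (n<1+n _) 2i+1<n) 2i+1<n
    χ1-2* : ∀ i → χ 1 (2 * i) ≡ χ 1 i
    χ1-2* zero    = refl
    χ1-2* (suc i) = refl
    lemma : ∀ d i a b c x → d + (2 * i + a + (b + c) + x) ≡ d + (i + x + c) + (i + a + b)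
    lemma = solve-∀

  edge-odd : ∀ i → suc (suc (2 * i)) < n →
    ∣ lab (suc (2 * i)) - lab (suc (suc (2 * i))) ∣
      + (suc (2 * i) + χ (2 * p) (suc (2 * i)) + χ (2 * r + t) (suc (2 * i)) + δ * 1) ≡ M + δ
  edge-odd i 2i+2<n = begin
    ∣ lab (suc (2 * i)) - lab (suc (suc (2 * i))) ∣
      + (suc (2 * i) + χ (2 * p) (suc (2 * i)) + χ (2 * r + t) (suc (2 * i)) + δ * 1)
      ≡⟨ cong₂ _+_ (trans (cong₂ ∣_-_∣ (zigzag-odd L H i) (zigzag-even (L ∘ suc) (H ∘ suc) i))
                     (trans (∣-∣-comm (H i) (L (suc i))) (m≤n⇒∣m-n∣≡n∸m (<⇒≤ L<))))
           (cong (_+ δ * 1) (cong₂ _+_ (cong (suc (2 * i) +_) (χ-odd p i)) (χ-odd-+ r i t+u≡1))) ⟩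
    d + (suc (2 * i) + χ p i + χ r i + δ * 1)
      ≡⟨ cong (λ y → d + (suc (2 * i) + χ p i + y + δ * 1)) (trans (cong (_* χ r i) t+u≡1) (*-identityˡ (χ r i))) ⟨
    d + (suc (2 * i) + χ p i + (t + u) * χ r i + δ * 1)
      -- `L (suc i)` contains `χ (suc r) (suc i)`, which reduces to `χ r i`; its share `t` and the
      -- share `u` from `X i` make up one full indicator.
      ≡⟨ lemma d i (χ p i) (χ r i) t u δ ⟩
    d + L (suc i) + X i       ≡⟨ cong (_+ X i) (m∸n+n≡m (<⇒≤ L<)) ⟩
    H i + X i                 ≡⟨ H+X {i} 2i+1<n ⟩
    M + δ                     ∎
    where
    open ≡-Reasoning
    2i+1<n : suc (2 * i) < n
    2i+1<n = <-trans (n<1+n _) 2i+2<n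
    L< : L (suc i) < H i
    L< = L<H {suc i} {i} (subst (_< n) (sym (*-suc 2 i)) 2i+2<n) 2i+1<n
    d : ℕ
    d = H i ∸ L (suc i)
    lemma : ∀ d i a b t u δ →
      d + (suc (2 * i) + a + (t + u) * b + δ * 1) ≡ d + (suc i + δ * 1 + t * b) + (i + a + u * b)
    lemma = solve-∀

  edge : ∀ {k} → suc k < n →
    ∣ lab k - lab (suc k) ∣ + (k + χ (2 * p) k + χ (2 * r + t) k + δ * χ 1 k) ≡ M + δ
  edge {k} k+1<n with half k
  ... | even i = edge-even i k+1<n
  ... | odd i  = edge-odd i k+1<n

  1≤2p : 1 ≤ 2 * p
  1≤2p = ≤-trans 1≤p (m≤m+n p _)

  1≤2r+t : 1 ≤ 2 * r + t
  1≤2r+t = ≤-trans 1≤2p 2p≤2r+t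

  first-edge : ∣ lab 0 - lab 1 ∣ ≡ M + δ
  first-edge = trans (sym (+-identityʳ _)) (trans (cong (∣ lab 0 - lab 1 ∣ +_)
    (sym (cong₂ _+_ (cong₂ _+_ (χ-> 1≤2p) (χ-> 1≤2r+t)) (*-zeroʳ δ)))) (edge 2≤n))
    where
    2≤n : 2 ≤ n
    2≤n = ≤-trans (s≤s (s≤s z≤n)) (≤-trans 3≤m (≤-trans (m≤n+m m (4 * T)) 4T+m≤n))

  edge-suc : ∀ {k a b} → suc (suc k) < n → χ (2 * p) (suc k) ≡ a → χ (2 * r + t) (suc k) ≡ b →
    ∣ lab (suc k) - lab (suc (suc k)) ∣ + (suc k + a + b) ≡ M
  edge-suc {k} k+2<n refl refl = +-cancelʳ-≡ δ _ _ (trans (lemma ∣ lab (suc k) - lab (suc (suc k)) ∣ (suc k) (χ (2 * p) (suc k)) (χ (2 * r + t) (suc k)) δ) (edge k+2<n))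
    where
    lemma : ∀ d k a b δ → d + (k + a + b) + δ ≡ d + (k + a + b + δ * 1)
    lemma = solve-∀

  edge-range : ∀ {k} → suc k < n → InRange M δ ∣ lab k - lab (suc k) ∣
  edge-range {zero}  _     = inj₂ first-edge
  edge-range {suc k} k+2<n = inj₁ (range _ _ _ (χ≤1 (2 * p) (suc k)) (χ≤1 (2 * r + t) (suc k)) (edge-suc k+2<n refl refl))
    where
    range : ∀ d a b → a ≤ 1 → b ≤ 1 → d + (suc k + a + b) ≡ M → 1 ≤ d × d + δ ≤ M
    range d a b a≤1 b≤1 eq =
      ≤-cert 2 (k+2<n ⊞ a≤1 ⊞ b≤1 ⊞ 3≤m ⊞ ≤-reflexive (sym M≡) ⊞ ≤-reflexive (sym eq))
        (solve (k ∷ n ∷ a ∷ b ∷ m ∷ M ∷ d ∷ []))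
      , ≤-cert (k + a + b) (δ≤1 ⊞ ≤-reflexive eq) (solve (δ ∷ d ∷ k ∷ a ∷ b ∷ M ∷ []))

  -- Position 0 has label 0, so the difference is the last label. The indicators that occur in it
  -- have all reached 1 there (or have coefficient 0), which makes the value independent of where
  -- exactly `e` was skipped.
  closing-edge : ∣ lab (2 * q + ε) - lab 0 ∣ ≡ e
  closing-edge = trans (cong (∣ lab (2 * q + ε) -_∣) lab0) (trans (∣-∣-identityʳ _) (last ε refl))
    where
    lab0 : lab 0 ≡ 0
    lab0 = cong₂ _+_ (*-zeroʳ δ) (*-zeroʳ t)
    1≤q : 1 ≤ q
    1≤q = ≤-trans (m≤n+m 1 (2 * T)) 2T<q
    χ1 : χ 1 q ≡ 1
    χ1 = χ-≤ 1≤q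
    -- The case split is on a copy of the module parameter `ε`, tied to it by an equation.
    last : ∀ ε′ → ε′ ≡ ε → lab (2 * q + ε′) ≡ e
    last zero refl = begin
      lab (2 * q + 0)             ≡⟨ cong lab (+-identityʳ (2 * q)) ⟩
      lab (2 * q)                 ≡⟨ zigzag-even L H q ⟩
      q + δ * χ 1 q + t * χ (suc r) q  ≡⟨ cong₂ (λ a b → q + a + b) (trans (cong (δ *_) χ1) (*-identityʳ δ)) (tχ t refl) ⟩
      q + δ + t                   ≡⟨ +-identityʳ _ ⟨
      q + δ + t + 0 * m           ≡⟨ e≡ ⟨
      e                           ∎
      where
      open ≡-Reasoning
      tχ : ∀ t′ → t′ ≡ t → t′ * χ (suc r) q ≡ t′
      tχ zero     _    = refl
      tχ (suc t′) refl = trans (cong (t *_) (χ-≤ r<q)) (*-identityʳ t)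
        where
        r<q : r < q
        r<q = ≤-cert₂ t′ 2r+t≤2q+ε (solve (r ∷ t′ ∷ q ∷ []))
    last (suc zero) refl = +-cancelʳ-≡ (X q) _ _ (begin
      lab (2 * q + 1) + X q       ≡⟨ cong (λ k → lab k + X q) (+-comm (2 * q) 1) ⟩
      lab (suc (2 * q)) + X q     ≡⟨ cong (_+ X q) (zigzag-odd L H q) ⟩
      H q + X q                   ≡⟨ H+X {q} (≤-reflexive (sym (trans n≡ (cong suc (+-comm (2 * q) 1))))) ⟩
      M + δ                       ≡⟨ gap-identity ⟨
      q + 1 + u + (m + (q + δ + t))  ≡⟨ cong (_+ (m + (q + δ + t))) (cong₂ (λ a b → q + a + b) (sym (χ-≤ p≤q)) (sym (trans (cong (u *_) (χ-≤ r≤q)) (*-identityʳ u)))) ⟩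
      X q + (m + (q + δ + t))     ≡⟨ lemma (X q) m (q + δ + t) ⟩
      q + δ + t + 1 * m + X q     ≡⟨ cong (_+ X q) e≡ ⟨
      e + X q                     ∎)
      where
      open ≡-Reasoning
      lemma : ∀ x m y → x + (m + y) ≡ y + 1 * m + x
      lemma = solve-∀
      r≤q : r ≤ q
      r≤q = ≤-cert₂ t 2r+t≤2q+ε (solve (r ∷ t ∷ q ∷ []))
      p≤q : p ≤ q
      p≤q = ≤-cert₂ 0 (≤-trans 2p≤2r+t 2r+t≤2q+ε) (solve (p ∷ q ∷ []))
    last (suc (suc ε′)) refl = contradiction ε≤1 λ { (s≤s ()) }

  e+δ≤M : e + δ ≤ M
  e+δ≤M = ≤-cert p (≤-reflexive e+2p≡M ⊞ 1≤p ⊞ δ≤1) (solve (e ∷ δ ∷ M ∷ p ∷ []))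

  path-hit : ∀ {v k a b} → suc k < n → χ (2 * p) k ≡ a → χ (2 * r + t) k ≡ b → δ * χ 1 k ≡ δ →
    v + (k + a + b) ≡ M → ∣ lab k - lab (suc k) ∣ ≡ v
  path-hit {v} {k} {a} {b} k+1<n refl refl δχ eq = +-cancelʳ-≡ (k + a + b + δ) _ _ (begin
    ∣ lab k - lab (suc k) ∣ + (k + a + b + δ)            ≡⟨ cong (λ x → ∣ lab k - lab (suc k) ∣ + (k + a + b + x)) δχ ⟨
    ∣ lab k - lab (suc k) ∣ + (k + a + b + δ * χ 1 k)    ≡⟨ edge k+1<n ⟩
    M + δ                                                ≡⟨ cong (_+ δ) eq ⟨
    v + (k + a + b) + δ                                  ≡⟨ +-assoc v (k + a + b) δ ⟩
    v + (k + a + b + δ)                                  ∎)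
    where open ≡-Reasoning

  -- The step with difference `v` is `M − v` minus the number of skipped values among `e` and `T`
  -- that exceed `v`. As `T < e`, this number is 0 above `e`, 1 between `T` and `e`, and 2 below
  -- `T`. For `δ = 1` the missing `M` causes no shift, since the first edge has `M + 1` in its
  -- place.
  path-onto : ∀ v → m ≤ v → v ≢ T → v ≢ e → v + δ ≤ M → ∃[ k ] (suc k < n × ∣ lab k - lab (suc k) ∣ ≡ v)
  path-onto v m≤v v≢T v≢e v+δ≤M with <-cmp v e | <-cmp v T
  ... | tri≈ _ v≡e _ | _ = contradiction v≡e v≢e
  ... | _ | tri≈ _ v≡T _ = contradiction v≡T v≢T
  ... | tri> _ _ e<v | _ = above (m≤n⇒∃[o]m+o≡n v+δ≤M)
    where
    above : (∃[ w ] v + δ + w ≡ M) → ∃[ k ] (suc k < n × ∣ lab k - lab (suc k) ∣ ≡ v)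
    above (w , eq) = w + δ , k+1<n
      , path-hit k+1<n (χ-> k<2p) (χ-> (≤-trans k<2p 2p≤2r+t)) (δχ δ≤1) (trans (lemma v w δ) eq)
      where
      k+1<n : suc (w + δ) < n
      k+1<n = ≤-cert 0 (e<v ⊞ T<e ⊞ m≤T ⊞ ≤-reflexive eq ⊞ ≤-reflexive M≡)
        (solve (w ∷ δ ∷ n ∷ e ∷ v ∷ T ∷ m ∷ M ∷ []))
      k<2p : w + δ < 2 * p
      k<2p = ≤-cert 0 (e<v ⊞ ≤-reflexive eq ⊞ ≤-reflexive (sym e+2p≡M))
        (solve (w ∷ δ ∷ p ∷ e ∷ v ∷ M ∷ []))
      lemma : ∀ v w δ → v + (w + δ + 0 + 0) ≡ v + δ + w
      lemma = solve-∀
      -- If `δ = 1`, the step `w + δ` is not the first one, so the raise of the low labels is in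
      -- force.
      δχ : ∀ {δ} → δ ≤ 1 → δ * χ 1 (w + δ) ≡ δ
      δχ z≤n       = refl
      δχ (s≤s z≤n) = trans (*-identityˡ _) (χ-≤ (m≤n+m 1 w))
  ... | tri< v<e _ _ | tri> _ _ T<v = between (m≤n⇒∃[o]m+o≡n v<M)
    where
    v<M : suc v ≤ M
    v<M = ≤-cert (2 * p) (v<e ⊞ ≤-reflexive e+2p≡M) (solve (v ∷ e ∷ p ∷ M ∷ []))
    between : (∃[ w ] suc v + w ≡ M) → ∃[ k ] (suc k < n × ∣ lab k - lab (suc k) ∣ ≡ v)
    between (w , eq) = w , k+1<n
      , path-hit k+1<n (χ-≤ 2p≤k) (χ-> k<2r+t) (trans (cong (δ *_) (χ-≤ (≤-trans 1≤2p 2p≤k))) (*-identityʳ δ))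
          (trans (lemma v w) eq)
      where
      k+1<n : suc w < n
      k+1<n = ≤-cert 0 (T<v ⊞ m≤T ⊞ ≤-reflexive eq ⊞ ≤-reflexive M≡)
        (solve (w ∷ n ∷ v ∷ T ∷ m ∷ M ∷ []))
      2p≤k : 2 * p ≤ w
      2p≤k = ≤-cert 0 (v<e ⊞ ≤-reflexive (sym eq) ⊞ ≤-reflexive e+2p≡M)
        (solve (w ∷ p ∷ e ∷ v ∷ M ∷ []))
      k<2r+t : w < 2 * r + t
      k<2r+t = ≤-cert 0 (T<v ⊞ ≤-reflexive eq ⊞ ≤-reflexive (sym 2r+t≡))
        (solve (w ∷ r ∷ t ∷ T ∷ v ∷ M ∷ []))
      lemma : ∀ v w → v + (w + 1 + 0) ≡ suc v + w
      lemma = solve-∀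
  ... | tri< v<e _ _ | tri< v<T _ _ = below (m≤n⇒∃[o]m+o≡n v+1<M)
    where
    v+1<M : suc (suc v) ≤ M
    v+1<M = ≤-cert (2 * p) (v<T ⊞ T<e ⊞ ≤-reflexive e+2p≡M) (solve (v ∷ T ∷ e ∷ p ∷ M ∷ []))
    below : (∃[ w ] suc (suc v) + w ≡ M) → ∃[ k ] (suc k < n × ∣ lab k - lab (suc k) ∣ ≡ v)
    below (w , eq) = w , k+1<n
      , path-hit k+1<n (χ-≤ (≤-trans 2p≤2r+t 2r+t≤k)) (χ-≤ 2r+t≤k)
          (trans (cong (δ *_) (χ-≤ (≤-trans 1≤2r+t 2r+t≤k))) (*-identityʳ δ)) (trans (lemma v w) eq)
      where
      k+1<n : suc w < n
      k+1<n = ≤-cert 0 (m≤v ⊞ ≤-reflexive eq ⊞ ≤-reflexive M≡)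
        (solve (w ∷ n ∷ v ∷ m ∷ M ∷ []))
      2r+t≤k : 2 * r + t ≤ w
      2r+t≤k = ≤-cert 0 (v<T ⊞ ≤-reflexive (sym eq) ⊞ ≤-reflexive 2r+t≡)
        (solve (w ∷ r ∷ t ∷ T ∷ v ∷ M ∷ []))
      lemma : ∀ v w → v + (w + 1 + 1) ≡ suc (suc v) + w
      lemma = solve-∀

  -- Up to `T`, which is at most `r`, the raise at `suc r` has not occurred, so the low labels are
  -- 0, 1, 2, ... for `δ = 0` and 0, 2, 3, ... for `δ = 1`. Label `x` thus sits at low index
  -- `x ∸ δ`, provided it is not the possibly missing 1.
  L-shift : ∀ {x} → x ≤ T → x ≢ 1 → L (x ∸ δ) ≡ x
  L-shift {x} x≤T x≢1 = begin
    x ∸ δ + δ * χ 1 (x ∸ δ) + t * χ (suc r) (x ∸ δ)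
      ≡⟨ cong₂ _+_ (shift x x≢1 δ≤1) (trans (cong (t *_) (χ-> (s≤s (≤-trans (m∸n≤m x δ) (≤-trans x≤T T≤r))))) (*-zeroʳ t)) ⟩
    x + 0                            ≡⟨ +-identityʳ x ⟩
    x                                ∎
    where
    open ≡-Reasoning
    shift : ∀ x → x ≢ 1 → ∀ {δ} → δ ≤ 1 → x ∸ δ + δ * χ 1 (x ∸ δ) ≡ x
    shift x             x≢1 z≤n       = +-identityʳ x
    shift zero          x≢1 (s≤s z≤n) = refl
    shift (suc zero)    x≢1 (s≤s z≤n) = contradiction refl x≢1
    shift (suc (suc x)) x≢1 (s≤s z≤n) = +-comm (suc x) 1

  -- Truncated subtraction need not be strictly monotone, but on these labels it is inverted by the
  -- increasing function `L`.
  shift-mono : ∀ {x y} → x < y → y ≤ T → x ≢ 1 → y ≢ 1 → x ∸ δ < y ∸ δ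
  shift-mono {x} {y} x<y y≤T x≢1 y≢1 = ≰⇒> λ le → contradiction (Lx≥Ly (m≤n⇒m<n∨m≡n le)) (<⇒≱ x<y)
    where
    Lx≥Ly : y ∸ δ < x ∸ δ ⊎ y ∸ δ ≡ x ∸ δ → y ≤ x
    Lx≥Ly y≤x = subst₂ _≤_ (L-shift y≤T y≢1) (L-shift (≤-trans (<⇒≤ x<y) y≤T) x≢1) (weak y≤x)
      where
      weak : ∀ {i j} → i < j ⊎ i ≡ j → L i ≤ L j
      weak (inj₁ i<j)  = <⇒≤ (L-mono i<j)
      weak (inj₂ refl) = ≤-refl

-- The chord cycle

module _ {m : ℕ} (s : Fin m → ℕ) (anti : ∀ {j k} → toℕ j < toℕ k → s k < s j) where

  antitone : ∀ {j k} → toℕ j ≤ toℕ k → s k ≤ s j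
  antitone j≤k with m≤n⇒m<n∨m≡n j≤k
  ... | inj₁ j<k = <⇒≤ (anti j<k)
  ... | inj₂ j≡k = ≤-reflexive (cong s (sym (toℕ-injective j≡k)))

  ¬between-consecutive : ∀ {j k} → toℕ k ≡ suc (toℕ j) → ∀ i → ¬ Between (s j) (s k) (s i)
  ¬between-consecutive {j} {k} k≡1+j i (inj₁ (sj<si , si<sk)) =
    contradiction (<-trans sj<si si<sk) (<-asym (anti (≤-reflexive (sym k≡1+j))))
  ¬between-consecutive {j} {k} k≡1+j i (inj₂ (sk<si , si<sj)) with toℕ i ≤? toℕ j
  ... | yes i≤j = contradiction si<sj (≤⇒≯ (antitone i≤j))
  ... | no  i≰j = contradiction sk<si (≤⇒≯ (antitone (≤-trans (≤-reflexive k≡1+j) (≰⇒> i≰j))))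

  between-extremes : ∀ {j k} → suc (toℕ j) ≡ m → toℕ k ≡ 0 → ∀ i → s j ≢ s i → s k ≢ s i →
    Between (s j) (s k) (s i)
  between-extremes {j} {k} last first i sj≢si sk≢si = inj₁
    ( ≤∧≢⇒< (antitone (s≤s⁻¹ (≤-trans (toℕ<n i) (≤-reflexive (sym last))))) sj≢si
    , ≤∧≢⇒< (antitone (≤-trans (≤-reflexive first) z≤n)) (sk≢si ∘ sym) )

  -- The corners appear in decreasing order. A chord between consecutive corners has no corner
  -- strictly inside; the closing chord joins the extremes and has every other corner inside. A
  -- crossing would need one endpoint inside and one outside.
  convex-noncrossing : ∀ j k j′ k′ → CycSucc m j k → ¬ Cross (s j) (s k) (s j′) (s k′)
  convex-noncrossing j k j′ k′ (inj₁ k≡1+j) (_ , inj₁ (b , _)) = ¬between-consecutive {j} {k} k≡1+j j′ b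
  convex-noncrossing j k j′ k′ (inj₁ k≡1+j) (_ , inj₂ (b , _)) = ¬between-consecutive {j} {k} k≡1+j k′ b
  convex-noncrossing j k j′ k′ (inj₂ (l , f)) ((_ , ≢₂ , _ , ≢₄) , inj₁ (_ , ¬b)) = ¬b (between-extremes l f k′ ≢₂ ≢₄)
  convex-noncrossing j k j′ k′ (inj₂ (l , f)) ((≢₁ , _ , ≢₃ , _) , inj₂ (_ , ¬b)) = ¬b (between-extremes l f j′ ≢₁ ≢₃)

-- The labelled graph

tri-mono : ∀ {i j} → i < j → tri i < tri j
tri-mono {zero}  (s≤s z≤n) = s≤s z≤n
tri-mono {suc i} (s≤s i<j) = +-mono-<-≤ (s≤s i<j) (<⇒≤ (tri-mono i<j))

tri-mono-≤ : ∀ {i j} → i ≤ j → tri i ≤ tri j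
tri-mono-≤ i≤j with m≤n⇒m<n∨m≡n i≤j
... | inj₁ i<j  = <⇒≤ (tri-mono i<j)
... | inj₂ refl = ≤-refl

Labelled : ℕ → ℕ → ℕ → ℕ → Set
Labelled m n M δ = Σ (TwoNestedCycles m n) λ G → Σ (Fin n → ℕ) λ f →
  Injective _≡_ _≡_ f ×
  (∀ v → f v ≤ M + δ) ×
  (∀ u v → Adj G u v → InRange M δ ∣ f u - f v ∣) ×
  (∀ k → InRange M δ k → ∃[ u ] ∃[ v ] (Adj G u v × ∣ f u - f v ∣ ≡ k))

module Construction
  (m₁ n M q ε δ t u r p e : ℕ)
  (n≡ : n ≡ suc (2 * q + ε)) (M≡ : M ≡ suc m₁ + n) (e≡ : e ≡ q + δ + t + ε * suc m₁)
  (e+2p≡M : e + 2 * p ≡ M) (2r+t≡ : 2 * r + t + tri m₁ + 1 ≡ M) (t+u≡1 : t + u ≡ 1)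
  (ε≤1 : ε ≤ 1) (δ≤1 : δ ≤ 1) (3≤m : 3 ≤ suc m₁) (m≤T : suc m₁ ≤ tri m₁)
  (4T+m≤n : 4 * tri m₁ + suc m₁ ≤ n)
  where

  m T : ℕ
  m = suc m₁
  T = tri m₁

  open Labelling m n M q ε δ t u r p T e n≡ M≡ e≡ e+2p≡M 2r+t≡ t+u≡1 ε≤1 δ≤1 3≤m m≤T 4T+m≤n

  m≤n : m ≤ n
  m≤n = ≤-trans (m≤n+m m (4 * T)) 4T+m≤n

  corner : ℕ → ℕ
  corner j = T ∸ tri j

  corner≤T : ∀ j → corner j ≤ T
  corner≤T j = m∸n≤m T (tri j)

  tri≤T : ∀ {j} → j < m → tri j ≤ T
  tri≤T (s≤s j≤m₁) = tri-mono-≤ j≤m₁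

  -- The last corner is 0; any earlier one is at least `m₁ ≥ 2`, because `T` still contains the
  -- summand `m₁`. This avoids the low label that is missing when `δ = 1`.
  corner≢1 : ∀ {j} → j < m → corner j ≢ 1
  corner≢1 {j} (s≤s j≤m₁) eq with m≤n⇒m<n∨m≡n j≤m₁
  ... | inj₂ refl = contradiction (trans (sym (n∸n≡0 T)) eq) λ ()
  ... | inj₁ j<m₁ = contradiction (≤-trans (s≤s⁻¹ 3≤m) (≤-trans (m+n≤o⇒m≤o∸n m₁ (big j<m₁)) (≤-reflexive eq))) 1+n≰n
    where
    big : ∀ {l} → j < l → l + tri j ≤ tri l
    big {suc l} (s≤s j≤l) = +-monoʳ-≤ (suc l) (tri-mono-≤ j≤l)

  corner-anti : ∀ {j k} → j < k → k < m → corner k < corner j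
  corner-anti j<k k<m = ∸-monoʳ-< (tri-mono j<k) (tri≤T k<m)

  corner-step : ∀ {j} → suc j < m → corner j ≡ corner (suc j) + suc j
  corner-step {j} j+1<m = +-cancelʳ-≡ (tri j) _ _ (begin
    corner j + tri j                  ≡⟨ m∸n+n≡m (tri≤T (<-trans (n<1+n j) j+1<m)) ⟩
    T                                 ≡⟨ m∸n+n≡m (tri≤T j+1<m) ⟨
    corner (suc j) + tri (suc j)      ≡⟨ +-assoc (corner (suc j)) (suc j) (tri j) ⟨
    corner (suc j) + suc j + tri j    ∎)
    where open ≡-Reasoning

  position : ℕ → ℕ
  position j = 2 * (corner j ∸ δ)

  -- The additional successor keeps chord vertices away from the last position, so that no chord is
  -- the wrap-around base edge.
  position<n : ∀ j → suc (position j) < n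
  position<n j = begin-strict
    suc (2 * (corner j ∸ δ))  ≤⟨ s≤s (*-monoʳ-≤ 2 (≤-trans (m∸n≤m (corner j) δ) (corner≤T j))) ⟩
    suc (2 * T)               ≤⟨ +-monoʳ-≤ 1 (*-monoˡ-≤ T {2} {4} (s≤s (s≤s z≤n))) ⟩
    1 + 4 * T                 <⟨ +-monoˡ-< (4 * T) (≤-trans (s≤s (s≤s z≤n)) 3≤m) ⟩
    m + 4 * T                 ≡⟨ +-comm m (4 * T) ⟩
    4 * T + m                 ≤⟨ 4T+m≤n ⟩
    n                         ∎
    where open ≤-Reasoning

  c : Fin m → Fin n
  c j = fromℕ< {position (toℕ j)} (<-trans (n<1+n _) (position<n (toℕ j)))

  toℕ-c : ∀ j → toℕ (c j) ≡ position (toℕ j)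
  toℕ-c j = toℕ-fromℕ< (<-trans (n<1+n _) (position<n (toℕ j)))

  f : Fin n → ℕ
  f v = lab (toℕ v)

  f-c : ∀ j → f (c j) ≡ corner (toℕ j)
  f-c j = trans (cong lab (toℕ-c j)) (trans (zigzag-even L H _)
    (L-shift (corner≤T (toℕ j)) (corner≢1 (toℕ<n j))))

  c-anti : ∀ {j k} → toℕ j < toℕ k → toℕ (c k) < toℕ (c j)
  c-anti {j} {k} j<k = subst₂ _<_ (sym (toℕ-c k)) (sym (toℕ-c j))
    (*-monoʳ-< 2 (shift-mono (corner-anti j<k (toℕ<n k)) (corner≤T (toℕ j)) (corner≢1 (toℕ<n k)) (corner≢1 (toℕ<n j))))

  c-injective : Injective _≡_ _≡_ c
  c-injective {j} {k} cj≡ck with <-cmp (toℕ j) (toℕ k)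
  ... | tri< j<k _ _ = contradiction (cong toℕ (sym cj≡ck)) (<⇒≢ (c-anti {j} {k} j<k))
  ... | tri≈ _ j≡k _ = toℕ-injective j≡k
  ... | tri> _ _ k<j = contradiction (cong toℕ cj≡ck) (<⇒≢ (c-anti {k} {j} k<j))

  -- All corners lie at even positions, whereas consecutive positions differ in parity.
  chord-not-base : ∀ j k → ¬ BaseAdj n (c j) (c k)
  chord-not-base j k (inj₁ eq) = even≢odd (corner (toℕ k) ∸ δ) (corner (toℕ j) ∸ δ)
    (trans (sym (toℕ-c k)) (trans eq (cong suc (toℕ-c j))))
  chord-not-base j k (inj₂ (eq , _)) = <⇒≢ (position<n (toℕ j)) (trans (cong suc (sym (toℕ-c j))) eq)

  graph : TwoNestedCycles m n
  graph = record
    { m≥3            = 3≤m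
    ; n≥3            = ≤-trans 3≤m m≤n
    ; c              = c
    ; c-inj          = c-injective
    ; chord-not-base = λ j k _ → chord-not-base j k , chord-not-base k j
    ; non-crossing   = λ j k j′ k′ jk _ → convex-noncrossing (toℕ ∘ c) (λ {j} {k} → c-anti {j} {k}) j k j′ k′ jk
    }

  base-range : ∀ {u v} → BaseAdj n u v → InRange M δ ∣ f u - f v ∣
  base-range {u} {v} (inj₁ eq) = subst (λ k → InRange M δ ∣ f u - lab k ∣) (sym eq)
    (edge-range (subst (_< n) eq (toℕ<n v)))
  base-range {u} {v} (inj₂ (u-last , v≡0)) = subst (InRange M δ)
    (sym (trans (cong₂ (λ j k → ∣ lab j - lab k ∣) (suc-injective (trans u-last n≡)) v≡0) closing-edge))
    (inj₁ (≤-trans (s≤s z≤n) T<e , e+δ≤M))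

  chord-diff : ∀ {j k} → toℕ k ≡ suc (toℕ j) → ∣ f (c j) - f (c k) ∣ ≡ toℕ k
  chord-diff {j} {k} k≡1+j = begin
    ∣ f (c j) - f (c k) ∣                          ≡⟨ cong₂ ∣_-_∣ (f-c j) (f-c k) ⟩
    ∣ corner (toℕ j) - corner (toℕ k) ∣            ≡⟨ cong (∣_- corner (toℕ k) ∣) step ⟩
    ∣ corner (toℕ k) + toℕ k - corner (toℕ k) ∣    ≡⟨ ∣-∣-comm (corner (toℕ k) + toℕ k) (corner (toℕ k)) ⟩
    ∣ corner (toℕ k) - corner (toℕ k) + toℕ k ∣    ≡⟨ ∣m-m+n∣≡n (corner (toℕ k)) (toℕ k) ⟩
    toℕ k                                          ∎
    where
    open ≡-Reasoning
    step : corner (toℕ j) ≡ corner (toℕ k) + toℕ k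
    step = subst (λ i → corner (toℕ j) ≡ corner i + i) (sym k≡1+j)
      (corner-step (subst (_< m) k≡1+j (toℕ<n k)))

  closing-chord : ∀ {j k} → suc (toℕ j) ≡ m → toℕ k ≡ 0 → ∣ f (c j) - f (c k) ∣ ≡ T
  closing-chord {j} {k} j-last k≡0 = trans (cong₂ ∣_-_∣ (f-c j) (f-c k))
    (trans (cong₂ (λ i l → ∣ corner i - corner l ∣) (suc-injective j-last) k≡0)
      (cong (∣_- T ∣) (n∸n≡0 T)))

  T-range : InRange M δ T
  T-range = inj₁ (1≤T , ≤-trans (+-monoˡ-≤ δ (<⇒≤ T<e)) e+δ≤M)

  chord-range : ∀ {j k} → CycSucc m j k → InRange M δ ∣ f (c j) - f (c k) ∣
  chord-range {j} {k} (inj₁ k≡1+j) = subst (InRange M δ) (sym (chord-diff {j} {k} k≡1+j))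
    (inj₁ (subst (1 ≤_) (sym k≡1+j) (s≤s z≤n) , (begin
      toℕ k + δ  ≤⟨ +-mono-≤ (<⇒≤ (toℕ<n k)) (≤-trans δ≤1 (≤-trans (s≤s z≤n) m≤n)) ⟩
      m + n      ≡⟨ M≡ ⟨
      M          ∎)))
    where open ≤-Reasoning
  chord-range {j} {k} (inj₂ (l , z)) = subst (InRange M δ) (sym (closing-chord {j} {k} l z)) T-range

  adj-range : ∀ u v → Adj graph u v → InRange M δ ∣ f u - f v ∣
  adj-range u v (inj₁ b)        = base-range b
  adj-range u v (inj₂ (inj₁ b)) = subst (InRange M δ) (∣-∣-comm (f v) (f u)) (base-range b)
  adj-range _ _ (inj₂ (inj₂ (j , k , s , inj₁ (refl , refl)))) = chord-range s
  adj-range _ _ (inj₂ (inj₂ (j , k , s , inj₂ (refl , refl)))) =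
    subst (InRange M δ) (∣-∣-comm (f (c j)) (f (c k))) (chord-range s)

  Attained : ℕ → Set
  Attained v = ∃[ x ] ∃[ y ] (Adj graph x y × ∣ f x - f y ∣ ≡ v)

  attained-edge : ∀ {k v} → suc k < n → ∣ lab k - lab (suc k) ∣ ≡ v → Attained v
  attained-edge {k} k+1<n eq = fromℕ< k<n , fromℕ< k+1<n
    , inj₁ (inj₁ (trans (toℕ-fromℕ< k+1<n) (cong suc (sym (toℕ-fromℕ< k<n)))))
    , trans (cong₂ (λ a b → ∣ lab a - lab b ∣) (toℕ-fromℕ< k<n) (toℕ-fromℕ< k+1<n)) eq
    where
    k<n : k < n
    k<n = <-trans (n<1+n k) k+1<n

  attained-e : Attained e
  attained-e = fromℕ< last<n , fromℕ< 0<n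
    , inj₁ (inj₂ (trans (cong suc (toℕ-fromℕ< last<n)) (sym n≡) , toℕ-fromℕ< 0<n))
    , trans (cong₂ (λ a b → ∣ lab a - lab b ∣) (toℕ-fromℕ< last<n) (toℕ-fromℕ< 0<n)) closing-edge
    where
    last<n : 2 * q + ε < n
    last<n = ≤-reflexive (sym n≡)
    0<n : 0 < n
    0<n = ≤-trans (s≤s z≤n) m≤n

  attained-chord : ∀ {j k v} → CycSucc m j k → ∣ f (c j) - f (c k) ∣ ≡ v → Attained v
  attained-chord {j} {k} s eq = c j , c k , inj₂ (inj₂ (j , k , s , inj₁ (refl , refl))) , eq

  attained-T : Attained T
  attained-T = attained-chord {fromℕ m₁} {F.zero} (inj₂ (cong suc (toℕ-fromℕ m₁) , refl))
    (closing-chord {fromℕ m₁} {F.zero} (cong suc (toℕ-fromℕ m₁)) refl)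

  attained-small : ∀ {v} → suc v < m → Attained (suc v)
  attained-small {v} v+1<m = attained-chord {fromℕ< v<m} {fromℕ< v+1<m} (inj₁ succ)
    (trans (chord-diff {fromℕ< v<m} {fromℕ< v+1<m} succ) (toℕ-fromℕ< v+1<m))
    where
    v<m : v < m
    v<m = <-trans (n<1+n v) v+1<m
    succ : toℕ (fromℕ< v+1<m) ≡ suc (toℕ (fromℕ< v<m))
    succ = trans (toℕ-fromℕ< v+1<m) (cong suc (sym (toℕ-fromℕ< v<m)))

  onto : ∀ v → InRange M δ v → Attained v
  onto v (inj₂ refl) = attained-edge (≤-trans (s≤s⁻¹ (≤-trans 3≤m (n≤1+n m))) m≤n) first-edge
  onto (suc v) (inj₁ (_ , v+δ≤M)) with suc v <? m | suc v ≟ T | suc v ≟ e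
  ... | yes v<m | _       | _       = attained-small v<m
  ... | no  _   | yes v≡T | _       = subst Attained (sym v≡T) attained-T
  ... | no  _   | no _    | yes v≡e = subst Attained (sym v≡e) attained-e
  ... | no  v≮m | no v≢T  | no v≢e  with path-onto (suc v) (≮⇒≥ v≮m) v≢T v≢e v+δ≤M
  ...   | k , k+1<n , eq = attained-edge k+1<n eq

  labelled : Labelled m n M δ
  labelled = graph , f , (λ {u} {v} eq → toℕ-injective (lab-injective (toℕ<n u) (toℕ<n v) eq))
    , (λ v → lab≤ (toℕ<n v)) , adj-range , onto

-- Choice of the parameters

halve : ∀ k → ∃₂ λ q ε → 2 * q + ε ≡ k × ε ≤ 1
halve k with half k
... | even i = i , 0 , +-identityʳ (2 * i) , z≤n
... | odd i  = i , 1 , +-comm (2 * i) 1 , ≤-refl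

even⇒double : ∀ k → parity k ≡ 0ℙ → ∃[ p ] k ≡ 2 * p
even⇒double k k-even with half k
... | even i = i , refl
... | odd i  = contradiction
  (trans (cong _⁻¹ (sym k-even)) (trans (ℙ.suc-homo-⁻¹ (2 * i)) (parity-2* i))) λ ()

-- This is `n * (n + 1) / 2` for `n = 2 * q + ε + 1`, halved in its even factor: `n + 1` if `ε = 0`
-- and `n` if `ε = 1`.
tri-2*+ : ∀ q {ε} → ε ≤ 1 → tri (suc (2 * q + ε)) ≡ suc q * suc (2 * (q + ε))
tri-2*+ q {ε} ε≤1 = *-cancelˡ-≡ _ _ 2 (trans (2*tri (suc (2 * q + ε))) (lemma ε≤1))
  where
  lemma₀ : ∀ q → suc (2 * q + 0) * suc (suc (2 * q + 0)) ≡ 2 * (suc q * suc (2 * (q + 0)))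
  lemma₀ = solve-∀
  lemma₁ : ∀ q → suc (2 * q + 1) * suc (suc (2 * q + 1)) ≡ 2 * (suc q * suc (2 * (q + 1)))
  lemma₁ = solve-∀
  lemma : ∀ {ε} → ε ≤ 1 → suc (2 * q + ε) * suc (suc (2 * q + ε)) ≡ 2 * (suc q * suc (2 * (q + ε)))
  lemma z≤n       = lemma₀ q
  lemma (s≤s z≤n) = lemma₁ q

-- Adding the even numbers `2 * (e + N)` and `tri N + δ` to `w` allows `e + w` and one further `N`
-- to be replaced by their known values. After expanding `e` and `tri N`, the terms `T`, `t`, `δ`
-- and `ε * m` each occur twice.
even-remainder : ∀ m₁ q ε δ t r w → let m = suc m₁; n = suc (2 * q + ε); e = q + δ + t + ε * m in
  ε ≤ 1 → parity (tri (m + n) + δ) ≡ 0ℙ → 2 * r + t + tri m₁ + 1 ≡ m + n → e + w ≡ m + n → parity w ≡ 0ℙ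
even-remainder m₁ q ε δ t r w ε≤1 δ-parity 2r+t≡ e+w≡ = begin
  parity w                                              ≡⟨ ℙ.+-identityʳ _ ⟨
  parity w ⊕ 0ℙ                                         ≡⟨ cong (parity w ⊕_) (parity-2* (e + N)) ⟨
  parity w ⊕ parity (2 * (e + N))                       ≡⟨ ℙ.+-homo-+ w _ ⟨
  parity (w + 2 * (e + N))                              ≡⟨ ℙ.+-identityʳ _ ⟨
  parity (w + 2 * (e + N)) ⊕ 0ℙ                         ≡⟨ cong (parity (w + 2 * (e + N)) ⊕_) δ-parity ⟨
  parity (w + 2 * (e + N)) ⊕ parity (tri N + δ)         ≡⟨ ℙ.+-homo-+ (w + 2 * (e + N)) _ ⟨
  parity (w + 2 * (e + N) + (tri N + δ))                ≡⟨ cong parity double ⟩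
  parity (2 * K)                                        ≡⟨ parity-2* K ⟩
  0ℙ                                                    ∎
  where
  open ≡-Reasoning
  m = suc m₁
  n = suc (2 * q + ε)
  e = q + δ + t + ε * m
  N = m + n
  T = tri m₁
  K = δ + t + N + r + T + q + 1 + suc q * (q + ε) + m * q + ε * m + m
  lemma₁ : ∀ w e N s → w + 2 * (e + N) + s ≡ e + w + N + (e + N) + s
  lemma₁ = solve-∀
  lemma₂ : ∀ m q ε δ t r T N →
    N + N + (q + δ + t + ε * m + (2 * r + t + T + 1)) + (m + T + suc q * suc (2 * (q + ε)) + m * suc (2 * q + ε) + δ)
    ≡ 2 * (δ + t + N + r + T + q + 1 + suc q * (q + ε) + m * q + ε * m + m)
  lemma₂ = solve-∀
  double : w + 2 * (e + N) + (tri N + δ) ≡ 2 * K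
  double = begin
    w + 2 * (e + N) + (tri N + δ)          ≡⟨ lemma₁ w e N (tri N + δ) ⟩
    e + w + N + (e + N) + (tri N + δ)      ≡⟨ cong₂ (λ a b → a + N + (e + b) + (tri N + δ)) e+w≡ (sym 2r+t≡) ⟩
    N + N + (e + (2 * r + t + T + 1)) + (tri N + δ)
      ≡⟨ cong (λ x → N + N + (e + (2 * r + t + T + 1)) + (x + δ))
           (trans (tri-+ m n) (cong (λ x → m + T + x + m * n) (tri-2*+ q ε≤1))) ⟩
    N + N + (e + (2 * r + t + T + 1)) + (m + T + suc q * suc (2 * (q + ε)) + m * n + δ)
      ≡⟨ lemma₂ m q ε δ t r T N ⟩
    2 * K                                  ∎

labelled-suc : ∀ m₁ n δ → 3 ≤ suc m₁ → suc m₁ ≤ tri m₁ → 4 * tri m₁ + suc m₁ ≤ n → δ ≤ 1 →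
  parity (tri (suc m₁ + n) + δ) ≡ 0ℙ → Labelled (suc m₁) n (suc m₁ + n) δ
labelled-suc m₁ zero δ 3≤m m≤T 4T+m≤n δ≤1 δ-parity = contradiction (m+n≤o⇒n≤o (4 * tri m₁) 4T+m≤n) λ ()
labelled-suc m₁ (suc n₁) δ 3≤m m≤T 4T+m≤n δ≤1 δ-parity
  -- `q` and `ε` come from `n − 1`, `r` and `t` from `M − T − 1`; the subtraction is not truncated,
  -- by `T+1≤N` below.
  with halve n₁ | halve (suc m₁ + suc n₁ ∸ (tri m₁ + 1))
... | q , ε , refl , ε≤1 | r , t , 2r+t≡M∸T∸1 , t≤1 = conclude (m≤n⇒∃[o]m+o≡n (e≤N (tri m₁) m 3≤m 4T+m≤n ε*m≤m))
  where
  m n e N : ℕ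
  m = suc m₁
  n = suc (2 * q + ε)
  e = q + δ + t + ε * m
  N = m + n
  ε*m≤m : ε * m ≤ m
  ε*m≤m = ≤-trans (*-monoˡ-≤ m ε≤1) (≤-reflexive (*-identityˡ m))
  e≤N : ∀ T m → 3 ≤ m → 4 * T + m ≤ suc (2 * q + ε) → ε * m ≤ m → q + δ + t + ε * m ≤ m + suc (2 * q + ε)
  e≤N T m 3≤m 4T+m≤n ε*m≤m = ≤-cert ε (+-mono-≤ (+-mono-≤ (+-mono-≤ δ≤1 t≤1) ε*m≤m) 1≤q)
    (solve (q ∷ ε ∷ δ ∷ t ∷ m ∷ []))
    where
    1≤q : 1 ≤ q
    1≤q = ≤-cert₂ (4 * T) (+-mono-≤ (+-mono-≤ 4T+m≤n ε≤1) 3≤m) (solve (T ∷ m ∷ q ∷ ε ∷ []))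
  T+1≤N : tri m₁ + 1 ≤ N
  T+1≤N = ≤-trans (+-mono-≤ (m≤m+n (tri m₁) (3 * tri m₁)) (s≤s z≤n)) (≤-trans 4T+m≤n (m≤n+m n m))
  2r+t+T+1≡N : 2 * r + t + tri m₁ + 1 ≡ N
  2r+t+T+1≡N = trans (+-assoc (2 * r + t) (tri m₁) 1)
    (trans (cong (_+ (tri m₁ + 1)) 2r+t≡M∸T∸1) (m∸n+n≡m T+1≤N))
  conclude : (∃[ w ] e + w ≡ N) → Labelled m n N δ
  conclude (w , e+w≡N)
    with even⇒double w (even-remainder m₁ q ε δ t r w ε≤1 δ-parity 2r+t+T+1≡N e+w≡N)
  -- `p` is half of the even remainder `M − e`.
  ... | p , refl = Construction.labelled m₁ n N q ε δ t (1 ∸ t) r p e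
    refl refl refl e+w≡N 2r+t+T+1≡N (m+[n∸m]≡n t≤1) ε≤1 δ≤1 3≤m m≤T 4T+m≤n

labelled : ∀ m n δ → 3 ≤ m → m * (2 * m ∸ 1) ≤ n → δ ≤ 1 → parity (tri (m + n) + δ) ≡ 0ℙ →
  Labelled m n (m + n) δ
labelled (suc (suc (suc l))) n δ 3≤m@(s≤s (s≤s (s≤s z≤n))) bound = labelled-suc m₁ n δ 3≤m
  (≤-cert (l + tri l) (≤-refl {0}) (lemma₁ l (tri l)))
  -- With `T = m (m − 1) / 2` the requirement `4 * T + m ≤ n` is exactly the assumed bound, as
  -- `2 m (m − 1) + m = m (2 m − 1)`.
  (≤-trans (≤-reflexive (trans (cong (_+ suc m₁) (*-assoc 2 2 (tri m₁)))
    (trans (cong (λ x → 2 * x + suc m₁) (2*tri m₁)) (lemma₂ m₁)))) bound)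
  where
  m₁ = suc (suc l)
  lemma₁ : ∀ l s → suc (suc (suc l)) + 0 + (l + s) ≡ suc (suc l) + (suc l + s) + 0
  lemma₁ = solve-∀
  lemma₂ : ∀ m₁ → 2 * (m₁ * suc m₁) + suc m₁ ≡ suc m₁ * (m₁ + suc (m₁ + 0))
  lemma₂ = solve-∀

-- Graceful and near-graceful graphs

labelled⇒graceful : ∀ {m n} → Labelled m n (m + n) 0 → Σ (TwoNestedCycles m n) Graceful
labelled⇒graceful {m} {n} (G , f , f-inj , f≤ , range , onto) = G , f , f-inj
  , (λ v → ≤-trans (f≤ v) (≤-reflexive (+-identityʳ _)))
  , (λ u v adj → bounds (range u v adj))
  , λ k 1≤k k≤M → onto k (inj₁ (1≤k , ≤-trans (≤-reflexive (+-identityʳ k)) k≤M))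
  where
  1≤M : 1 ≤ m + n
  1≤M = ≤-trans (≤-trans (s≤s z≤n) (TwoNestedCycles.m≥3 G)) (m≤m+n m n)
  bounds : ∀ {k} → InRange (m + n) 0 k → 1 ≤ k × k ≤ m + n
  bounds (inj₁ (1≤k , k≤M)) = 1≤k , ≤-trans (≤-reflexive (sym (+-identityʳ _))) k≤M
  bounds (inj₂ refl)        = ≤-trans 1≤M (m≤m+n _ 0) , ≤-reflexive (+-identityʳ _)

labelled⇒nearGraceful : ∀ {m n} → parity (tri (m + n)) ≡ 1ℙ → Labelled m n (m + n) 1 →
  Σ (TwoNestedCycles m n) NearGraceful
labelled⇒nearGraceful {m} {n} M-odd (G , f , f-inj , f≤ , range , onto) = G
  , (λ g → contradiction (trans (sym M-odd) (graceful⇒even G g)) λ ())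
  , f , f-inj
  , (λ v → ≤-trans (f≤ v) (≤-reflexive (+-comm (m + n) 1)))
  , (λ u v adj → to (range u v adj))
  , λ k k-range → onto k (from k-range)
  where
  to : ∀ {k} → InRange (m + n) 1 k → NGRange G k
  to (inj₁ (1≤k , k+1≤M)) = inj₁ (1≤k , m+n≤o⇒m≤o∸n _ k+1≤M)
  to (inj₂ eq)            = inj₂ (trans eq (+-comm (m + n) 1))
  1≤M : 1 ≤ m + n
  1≤M = ≤-trans (≤-trans (s≤s z≤n) (TwoNestedCycles.m≥3 G)) (m≤m+n m n)
  from : ∀ {k} → NGRange G k → InRange (m + n) 1 k
  from (inj₁ (1≤k , k≤M∸1)) = inj₁ (1≤k , ≤-trans (+-monoˡ-≤ 1 k≤M∸1) (≤-reflexive (m∸n+n≡m 1≤M)))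
  from (inj₂ eq)            = inj₂ (trans eq (+-comm 1 (m + n)))

theorem3 : (m₁ m₂ : ℕ) → 3 ≤ m₁ → m₁ * (2 * m₁ ∸ 1) ≤ m₂ →
    (((m₁ + m₂) % 4 ≡ 0 ⊎ (m₁ + m₂) % 4 ≡ 3) →
    Σ (TwoNestedCycles m₁ m₂) Graceful) ×
    (((m₁ + m₂) % 4 ≡ 1 ⊎ (m₁ + m₂) % 4 ≡ 2) →
    Σ (TwoNestedCycles m₁ m₂) NearGraceful)
theorem3 m₁ m₂ 3≤m₁ bound =
    (λ h → labelled⇒graceful (labelled m₁ m₂ 0 3≤m₁ bound z≤n
      (trans (cong parity (+-identityʳ (tri N))) (residue (evenResidue h)))))
  , (λ h → labelled⇒nearGraceful (residue (oddResidue h)) (labelled m₁ m₂ 1 3≤m₁ bound ≤-refl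
      (trans (ℙ.+-homo-+ (tri N) 1) (cong (_⊕ 1ℙ) (residue (oddResidue h))))))
  where
  N = m₁ + m₂
  residue : ∀ {π} → parity (tri (N % 4)) ≡ π → parity (tri N) ≡ π
  residue = trans (parity-tri-%4 N)
  -- On the residues 0, 1, 2, 3 `tri` takes the values 0, 1, 3, 6, so these parities hold by
  -- evaluation.
  evenResidue : N % 4 ≡ 0 ⊎ N % 4 ≡ 3 → parity (tri (N % 4)) ≡ 0ℙ
  evenResidue = [ cong (parity ∘ tri) , cong (parity ∘ tri) ]′
  oddResidue : N % 4 ≡ 1 ⊎ N % 4 ≡ 2 → parity (tri (N % 4)) ≡ 1ℙ
  oddResidue = [ cong (parity ∘ tri) , cong (parity ∘ tri) ]′
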